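{- There is a constant $c$ such that for every graph $G$, $\mathrm{tw}(G)\leq c\,\Delta(G)^4\,\mathrm{stw}(G)^2\log|V(G)|$, where $\mathrm{tw}$ is treewidth and $\Delta$ is maximum degree.
   Context: All graphs are finite and simple. A partition sequence of an $n$-vertex graph $G$ is a sequence $\mathcal P_n,\dots,\mathcal P_1$ of partitions of $V(G)$ such that $\mathcal P_n$ is the partition into singletons, $\mathcal P_1=\{V(G)\}$, and each $\mathcal P_i$ ($i<n$) is obtained from $\mathcal P_{i+1}$ by merging two parts. Two distinct parts $X,Y$ are inhomogeneous if there are $u,u'\in X$, $v,v'\in Y$ with $uv\in E(G)$, $u'v'\notin E(G)$. The red graph $\mathcal R(\mathcal P)$ has vertex set $\mathcal P$ and edges between inhomogeneous parts. For a total order $\prec$ on $V(G)$ and $X\subseteq V(G)$, the span $\langle X\rangle=\{v:\min X\preceq v\preceq\max X\}$; $X,Y$ conflict if their spans intersect. For $X\in\mathcal P$, a part $Y\in\mathcal P\setminus\{X\}$ interferes with $X$ if $Y$ conflicts with the union of the parts in the closed neighborhood of $X$ in $\mathcal R(\mathcal P)$; the stretch of $X$ is the number of parts interfering with $X$; the stretch of $\mathcal P$ is the maximum stretch of a part. $\mathrm{stw}(G,\prec)$ is the minimum over partition sequences of the maximum stretch of its partitions, and $\mathrm{stw}(G)=\min_\prec \mathrm{stw}(G,\prec)$.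
   Formalization: In the bound, stw(G) is replaced by max(stw(G),1), because as written the claim fails when stw(G)=0 and G has an edge (for K_2, stw=0 but tw=1); for stw(G)≥1 the statement is unchanged. -}

module Defs where

open import Data.Nat using (ℕ; zero; suc; _+_; _*_; _^_; _≤_; _<_; _⊔_)
open import Data.Nat.Logarithm using (⌊log₂_⌋)
open import Data.Fin using (Fin)
open import Data.Bool using (Bool; true; false; if_then_else_)
open import Data.List using (List; []; _∷_; _++_; [_]; length; map; foldr; allFin)
open import Data.Nat.ListAction using (sum)
open import Data.Empty using (⊥)
open import Data.List.Relation.Unary.Any using (Any)
open import Data.List.Relation.Unary.Linked using (Linked)
open import Data.List.Relation.Unary.Unique.Propositional using (Unique)
open import Data.Product using (Σ; ∃; _×_; _,_)
open import Data.Sum using (_⊎_)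
open import Data.Unit using (⊤)
open import Relation.Nullary using (¬_)
open import Relation.Binary.PropositionalEquality using (_≡_; _≢_)
open import Function.Definitions using (Injective)

record Graph (n : ℕ) : Set where
  field
    adj   : Fin n → Fin n → Bool
    sym   : ∀ u v → adj u v ≡ adj v u
    irrefl : ∀ v → adj v v ≡ false
open Graph public

count : ∀ {n} → (Fin n → Bool) → ℕ
count {n} p = sum (map (λ u → if p u then 1 else 0) (allFin n))

degree : ∀ {n} → Graph n → Fin n → ℕ
degree G v = count (adj G v)

maxDegree : ∀ {n} → Graph n → ℕ
maxDegree {n} G = foldr _⊔_ 0 (map (degree G) (allFin n))

data Reach {m : ℕ} (T : Graph m) (S : Fin m → Set) : Fin m → Fin m → Set where
  here : ∀ {u} → S u → Reach T S u u
  step : ∀ {u w v} → S u → adj T u w ≡ true → Reach T S w v → Reach T S u v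

Connected : ∀ {m} → Graph m → Set
Connected T = ∀ u v → Reach T (λ _ → ⊤) u v

IsCycle : ∀ {m} → Graph m → List (Fin m) → Set
IsCycle T [] = ⊥
IsCycle T (x ∷ xs) =
  3 ≤ length (x ∷ xs) × Unique (x ∷ xs) ×
  Linked (λ a b → adj T a b ≡ true) ((x ∷ xs) ++ [ x ])

Acyclic : ∀ {m} → Graph m → Set
Acyclic T = ∀ c → ¬ IsCycle T c

IsTree : ∀ {m} → Graph m → Set
IsTree T = Connected T × Acyclic T

record TreeDecomposition {n : ℕ} (G : Graph n) (k : ℕ) : Set where
  field
    m      : ℕ
    tree   : Graph (suc m)
    isTree : IsTree tree
    bag    : Fin (suc m) → Fin n → Bool
    cover-vertices : ∀ v → ∃ λ t → bag t v ≡ true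
    cover-edges    : ∀ u v → adj G u v ≡ true →
                     ∃ λ t → bag t u ≡ true × bag t v ≡ true
    connected-bags : ∀ v t t' → bag t v ≡ true → bag t' v ≡ true →
                     Reach tree (λ s → bag s v ≡ true) t t'
    width≤ : ∀ t → count (bag t) ≤ suc k

TwLe : ∀ {n} → Graph n → ℕ → Set
TwLe G k = TreeDecomposition G k

-- Partitions of Fin n, represented by a labelling: u and v lie in the
-- same part iff they have the same label.  A part is referred to by any
-- of its vertices (a representative).

Partition : ℕ → Set
Partition n = Fin n → ℕ

Singletons : ∀ {n} → Partition n → Set
Singletons P = Injective _≡_ _≡_ P

Whole : ∀ {n} → Partition n → Set
Whole P = ∀ u v → P u ≡ P v

MergeOf : ∀ {n} → Partition n → Partition n → Set
MergeOf {n} P Q = Σ (Fin n) λ x → Σ (Fin n) λ y → P x ≢ P y ×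
  (∀ u v → (Q u ≡ Q v →
              P u ≡ P v ⊎ (P u ≡ P x × P v ≡ P y) ⊎ (P u ≡ P y × P v ≡ P x))
         × (P u ≡ P v ⊎ (P u ≡ P x × P v ≡ P y) ⊎ (P u ≡ P y × P v ≡ P x) →
              Q u ≡ Q v))

-- A partition sequence P_n, …, P_1, given as seq i = P_i for 1 ≤ i ≤ n
record PartitionSequence (n : ℕ) : Set where
  field
    seq     : ℕ → Partition n
    first   : Singletons (seq n)
    last    : Whole (seq 1)
    merges  : ∀ i → 1 ≤ i → i < n → MergeOf (seq (suc i)) (seq i)
open PartitionSequence public

-- Red graph, spans, interference, stretch.
-- A total order ≺ on Fin n is given by an injective position map
-- pos : Fin n → ℕ  (u ≺ v iff pos u < pos v).

Inhomogeneous : ∀ {n} → Graph n → Partition n → Fin n → Fin n → Set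
Inhomogeneous {n} G P x y = P x ≢ P y ×
  Σ (Fin n) λ u → Σ (Fin n) λ u' → Σ (Fin n) λ v → Σ (Fin n) λ v' →
    P u ≡ P x × P u' ≡ P x × P v ≡ P y × P v' ≡ P y ×
    adj G u v ≡ true × adj G u' v' ≡ false

InSpan : ∀ {n} → (Fin n → ℕ) → (Fin n → Set) → Fin n → Set
InSpan {n} pos X w = Σ (Fin n) λ a → Σ (Fin n) λ b →
  X a × X b × pos a ≤ pos w × pos w ≤ pos b

Conflict : ∀ {n} → (Fin n → ℕ) → (Fin n → Set) → (Fin n → Set) → Set
Conflict pos X Y = ∃ λ w → InSpan pos X w × InSpan pos Y w

-- the union of the parts in the closed red neighbourhood of the part of x
ClosedNbhdUnion : ∀ {n} → Graph n → Partition n → Fin n → Fin n → Set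
ClosedNbhdUnion G P x w = P w ≡ P x ⊎ Inhomogeneous G P x w

Interferes : ∀ {n} → Graph n → (Fin n → ℕ) → Partition n → Fin n → Fin n → Set
Interferes G pos P x y =
  P y ≢ P x × Conflict pos (λ w → P w ≡ P y) (ClosedNbhdUnion G P x)

StretchLe : ∀ {n} → Graph n → (Fin n → ℕ) → Partition n → Fin n → ℕ → Set
StretchLe {n} G pos P x s = Σ (List (Fin n)) λ L → length L ≤ s ×
  (∀ y → Interferes G pos P x y → Any (λ z → P z ≡ P y) L)

StwOrdLe : ∀ {n} → Graph n → (Fin n → ℕ) → ℕ → Set
StwOrdLe {n} G pos s = Σ (PartitionSequence n) λ S →
  ∀ i → 1 ≤ i → i ≤ n → ∀ x → StretchLe G pos (seq S i) x s

StwLe : ∀ {n} → Graph n → ℕ → Set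
StwLe {n} G s = Σ (Fin n → ℕ) λ pos → Injective _≡_ _≡_ pos × StwOrdLe G pos s

module Submission where

open import Defs
open import Data.Nat
open import Data.Nat.ListAction using (sum)
open import Data.Nat.Logarithm using (⌊log₂_⌋; ⌊log₂⌋-mono-≤; ⌊log₂[2^n]⌋≡n)
open import Data.Nat.Properties
open import Data.Nat.Tactic.RingSolver using (solve-∀)
open import Data.Bool using (Bool; true; false; if_then_else_; _∨_)
import Data.Bool.Properties as Bool
open import Data.Empty using (⊥-elim)
open import Data.Fin as Fin using (Fin; zero; suc; splitAt; join; fromℕ<)
open import Data.Fin.Properties using (splitAt-join; join-splitAt; any?; all?)
open import Data.List as List using (List; []; _∷_; _++_; length; allFin; filter; foldr; concatMap)
open import Data.List.Membership.Propositional using (_∈_; find; lose)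
open import Data.List.Membership.Propositional.Properties
  using (∈-filter⁺; ∈-allFin; ∈-concatMap⁺; ∈-++⁺ˡ; ∈-++⁺ʳ; ∈-map⁺)
open import Data.List.Properties using (filter-notAll; length-++; length-tabulate)
open import Data.List.Relation.Unary.All as All using (All; []; _∷_)
open import Data.List.Relation.Unary.AllPairs using (_∷_)
open import Data.List.Relation.Unary.Any as Any using (Any; here; there)
import Data.List.Relation.Unary.Any.Properties as Any
open import Data.List.Relation.Unary.Linked using (Linked; [-]; _∷_)
open import Data.List.Relation.Unary.Unique.Propositional using (Unique)
open import Data.List.Relation.Unary.Unique.Propositional.Properties using (allFin⁺)
open import Data.Product using (Σ; ∃; _×_; _,_; proj₁; proj₂)
open import Data.Sum as Sum using (_⊎_; inj₁; inj₂; map; map₁; [_,_]′)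
open import Data.Unit using (⊤; tt)
open import Function using (_∘_; id)
open import Function.Definitions using (Injective)
open import Relation.Binary.Construct.Closure.ReflexiveTransitive
  using (Star; ε; _◅_; _◅◅_; gmap; reverse)
open import Relation.Binary.PropositionalEquality as ≡ using (_≡_; _≢_; refl; cong)
open import Relation.Nullary
  using (¬_; contradiction; Dec; yes; no; ¬?; _×-dec_; _⊎-dec_; _→-dec_; ⌊_⌋)
open import Relation.Unary using (Decidable)

-- Call an edge dead for a partition P if it lies inside a part or joins two red
-- neighbours. The vertices between the ends of a dead edge lie in at most s + 1
-- parts; an edge that is not dead has each end in a part of at most Δ vertices.
-- Hence an interval I meeting few parts is left by few edges (up to a hitting set)
-- once few dead edges cross its two end positions, so it is enough to find positions
-- crossed by few dead edges inside every interval that meets many parts of P.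
-- Halve such an interval so that both halves meet more than s + 1 parts and take the
-- smaller half I′. No dead edge crossing I′ jumps over I′, so each has an end in I′.
-- Choose the partition P′ of the sequence at which I′ meets just more than the
-- threshold number of parts: of the edges with an end in I′, those not dead for P′ are
-- hit by O(s Δ) vertices, and the dead ones are handled by recursion on I′ and P′,
-- at depth at most log n. Cutting at such positions while refining the partitions
-- yields a binary tree of intervals whose edge cuts are hit by O(s Δ log n) vertices,
-- and such a tree gives a tree decomposition of width O(s Δ² log n).

-- Rooted binary trees as graphs

-- A walk that never turns straight back along an edge; the indices are its
-- first two and its last two vertices.
data Track {m} (T : Graph m) (a : Fin m) : Fin m → Fin m → Fin m → Set where
  edge : ∀ {b} → adj T a b ≡ true → Track T a b a b
  cons : ∀ {b c y z} → adj T a b ≡ true → a ≢ c → Track T b c y z → Track T a b y z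

first-edge : ∀ {m} {T : Graph m} {a b y z} → Track T a b y z → adj T a b ≡ true
first-edge (edge e)     = e
first-edge (cons e _ _) = e

last-edge : ∀ {m} {T : Graph m} {a b y z} → Track T a b y z → adj T y z ≡ true
last-edge (edge e)     = e
last-edge (cons _ _ τ) = last-edge τ

-- Distinctness of the listed vertices rules out turning back. The membership of `y` is kept: on a
-- cycle it shows that the first and the last edge meet the base vertex at different neighbours.
path⇒track : ∀ {m} {T : Graph m} {z} a b l → Linked (λ u v → adj T u v ≡ true) (a ∷ b ∷ l ++ z ∷ []) →
  Unique (a ∷ b ∷ l) → All (_≢ z) (a ∷ b ∷ l) → ∃ λ y → y ∈ b ∷ l × Track T a b y z
path⇒track a b [] (e ∷ e′ ∷ [-]) _ (a≢z ∷ _) = b , here refl , cons e a≢z (edge e′)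
path⇒track a b (c ∷ l) (e ∷ es) ((_ ∷ a≢c ∷ _) ∷ u) (_ ∷ ≢z)
  with y , y∈ , τ ← path⇒track b c l es u ≢z = y , there y∈ , cons e a≢c τ

module _ {m} (T : Graph m) (depth : Fin m → ℕ)
  (comparable : ∀ u v → adj T u v ≡ true → depth u < depth v ⊎ depth v < depth u)
  (unique-parent : ∀ u v w → adj T u v ≡ true → adj T u w ≡ true →
                   depth v < depth u → depth w < depth u → v ≡ w) where

  private
    adj-sym : ∀ {u v} → adj T u v ≡ true → adj T v u ≡ true
    adj-sym {u} {v} = ≡.trans (sym T v u)

  -- If a step down from `a` to `b` were followed by a step up to `c`, then `a` and `c` would both
  -- be the parent of `b`, against `a ≢ c`.
  descending : ∀ {a b y z} → Track T a b y z → depth a < depth b → depth a < depth z × depth y < depth z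
  descending (edge _) a<b = a<b , a<b
  descending (cons e a≢c τ) a<b with comparable _ _ (first-edge τ)
  ... | inj₁ b<c with b<z , y<z ← descending τ b<c = <-trans a<b b<z , y<z
  ... | inj₂ c<b = contradiction (unique-parent _ _ _ (adj-sym e) (first-edge τ) a<b c<b) a≢c

  ascending : ∀ {a b y z} → Track T a b y z → depth z < depth a ⊎ depth y < depth z
  ascending (edge e) with comparable _ _ e
  ... | inj₁ a<b = inj₂ a<b
  ... | inj₂ b<a = inj₁ b<a
  ascending t@(cons e _ τ) with comparable _ _ e
  ... | inj₁ a<b = inj₂ (proj₂ (descending t a<b))
  ... | inj₂ b<a = map₁ (λ z<b → <-trans z<b b<a) (ascending τ)

  -- Once a track goes down it keeps going down, so a closed track must leave its
  -- first vertex x towards the parent of x and come back from the parent of x.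
  unique-parent⇒acyclic : Acyclic T
  unique-parent⇒acyclic (_ ∷ []) (s≤s () , _)
  unique-parent⇒acyclic (_ ∷ _ ∷ []) (s≤s (s≤s ()) , _)
  unique-parent⇒acyclic (x ∷ y ∷ c ∷ l) (_ , (x≢y ∷ x≢c ∷ x≢l) ∷ u@(y≢ ∷ _) , e ∷ es)
    with w , w∈ , τ ← path⇒track y c l es u (All.map (_∘ ≡.sym) (x≢y ∷ x≢c ∷ x≢l))
    with comparable _ _ e | ascending (cons e x≢c τ)
  ... | inj₁ x<y | _        = <-irrefl refl (proj₁ (descending (cons e x≢c τ) x<y))
  ... | inj₂ _   | inj₁ x<x = <-irrefl refl x<x
  ... | inj₂ y<x | inj₂ w<x =
    All.lookup y≢ w∈ (unique-parent _ _ _ e (adj-sym (last-edge τ)) y<x w<x)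

data Shape : Set where
  leaf : Shape
  node : Shape → Shape → Shape

data Node : Shape → Set where
  root  : ∀ {t} → Node t
  left  : ∀ {l r} → Node l → Node (node l r)
  right : ∀ {l r} → Node r → Node (node l r)

-- One less than the number of nodes, to match the index type `Fin (suc m)` of a tree decomposition.
edges : Shape → ℕ
edges leaf       = 0
edges (node l r) = suc (edges l) + suc (edges r)

encode : ∀ {t} → Node t → Fin (suc (edges t))
encode root                 = zero
encode {node l r} (left x)  = suc (join (suc (edges l)) _ (inj₁ (encode x)))
encode {node l r} (right x) = suc (join (suc (edges l)) _ (inj₂ (encode x)))

decode : ∀ {t} → Fin (suc (edges t)) → Node t
decode zero = root
decode {node l r} (suc i) with splitAt (suc (edges l)) i
... | inj₁ j = left (decode j)
... | inj₂ j = right (decode j)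

decode-encode : ∀ {t} (x : Node t) → decode (encode x) ≡ x
decode-encode root = refl
decode-encode {node l r} (left x)
  rewrite splitAt-join (suc (edges l)) (suc (edges r)) (inj₁ (encode x)) = cong left (decode-encode x)
decode-encode {node l r} (right x)
  rewrite splitAt-join (suc (edges l)) (suc (edges r)) (inj₂ (encode x)) = cong right (decode-encode x)

encode-decode : ∀ {t} (i : Fin (suc (edges t))) → encode {t} (decode i) ≡ i
encode-decode zero = refl
encode-decode {node l r} (suc i)
  with splitAt (suc (edges l)) i | join-splitAt (suc (edges l)) (suc (edges r)) i
... | inj₁ j | eq = cong suc (≡.trans (cong (join (suc (edges l)) _ ∘ inj₁) (encode-decode j)) eq)
... | inj₂ j | eq = cong suc (≡.trans (cong (join (suc (edges l)) _ ∘ inj₂) (encode-decode j)) eq)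

isRoot : ∀ {t} → Node t → Bool
isRoot root = true
isRoot _    = false

link : ∀ {t} → Node t → Node t → Bool
link root      root      = false
link root      (left y)  = isRoot y
link root      (right y) = isRoot y
link (left x)  root      = isRoot x
link (left x)  (left y)  = link x y
link (left x)  (right y) = false
link (right x) root      = isRoot x
link (right x) (left y)  = false
link (right x) (right y) = link x y

link-sym : ∀ {t} (x y : Node t) → link x y ≡ link y x
link-sym root      root      = refl
link-sym root      (left y)  = refl
link-sym root      (right y) = refl
link-sym (left x)  root      = refl
link-sym (left x)  (left y)  = link-sym x y
link-sym (left x)  (right y) = refl
link-sym (right x) root      = refl
link-sym (right x) (left y)  = refl
link-sym (right x) (right y) = link-sym x y

link-irrefl : ∀ {t} (x : Node t) → link x x ≡ false
link-irrefl root      = refl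
link-irrefl (left x)  = link-irrefl x
link-irrefl (right x) = link-irrefl x

level : ∀ {t} → Node t → ℕ
level root      = 0
level (left x)  = suc (level x)
level (right x) = suc (level x)

link-comparable : ∀ {t} (x y : Node t) → link x y ≡ true → level x < level y ⊎ level y < level x
link-comparable root      (left y)  _ = inj₁ z<s
link-comparable root      (right y) _ = inj₁ z<s
link-comparable (left x)  root      _ = inj₂ z<s
link-comparable (left x)  (left y)  e = map s<s s<s (link-comparable x y e)
link-comparable (right x) root      _ = inj₂ z<s
link-comparable (right x) (right y) e = map s<s s<s (link-comparable x y e)

link-unique-parent : ∀ {t} (x y z : Node t) → link x y ≡ true → link x z ≡ true →
  level y < level x → level z < level x → y ≡ z
link-unique-parent (left x)    root      root      _ _ _ _ = refl
link-unique-parent (left root) root      (left z)  _ _ _ (s≤s ())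
link-unique-parent (left root) (left y)  _         _ _ (s≤s ())
link-unique-parent (left (left _))  (left y) root _ ()
link-unique-parent (left (right _)) (left y) root _ ()
link-unique-parent (left x)    (left y)  (left z)  e f (s≤s p) (s≤s q) = cong left (link-unique-parent x y z e f p q)
link-unique-parent (right x)    root      root      _ _ _ _ = refl
link-unique-parent (right root) root      (right z)  _ _ _ (s≤s ())
link-unique-parent (right root) (right y)  _         _ _ (s≤s ())
link-unique-parent (right (left _))  (right y) root _ ()
link-unique-parent (right (right _)) (right y) root _ ()
link-unique-parent (right x)    (right y)  (right z)  e f (s≤s p) (s≤s q) = cong right (link-unique-parent x y z e f p q)

treeGraph : ∀ t → Graph (suc (edges t))
treeGraph t = record
  { adj    = λ u v → link {t} (decode u) (decode v)
  ; sym    = λ u v → link-sym {t} (decode u) (decode v)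
  ; irrefl = λ v → link-irrefl {t} (decode v)
  }

-- Membership is demanded at both ends, which makes walks reversible. `star⇒reach` asks for it again
-- at the end because an empty walk carries none.
Step : ∀ {t} → (Node t → Set) → Node t → Node t → Set
Step S x y = S x × S y × link x y ≡ true

star-sym : ∀ {t} (S : Node t → Set) {x y} → Star (Step S) x y → Star (Step S) y x
star-sym S = reverse λ {x} {y} (sx , sy , e) → sy , sx , ≡.trans (link-sym y x) e

star-left : ∀ {l r} {S : Node (node l r) → Set} {x y} →
  Star (Step (S ∘ left)) x y → Star (Step S) (left x) (left y)
star-left = gmap left (λ s → s)

star-right : ∀ {l r} {S : Node (node l r) → Set} {x y} →
  Star (Step (S ∘ right)) x y → Star (Step S) (right x) (right y)
star-right = gmap right (λ s → s)

star⇒reach : ∀ {t} {S : Fin (suc (edges t)) → Set} {x y} → S (encode y) →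
  Star (Step (S ∘ encode {t})) x y → Reach (treeGraph t) S (encode x) (encode y)
star⇒reach sy ε = here sy
star⇒reach {t} sy (_◅_ {x} {z} (sx , _ , e) p) =
  step sx (≡.trans (≡.cong₂ link (decode-encode x) (decode-encode z)) e) (star⇒reach {t} sy p)

root-reach : ∀ {t} (x : Node t) → Star (Step (λ _ → ⊤)) root x
root-reach root      = ε
root-reach (left x)  = (tt , tt , refl) ◅ star-left (root-reach x)
root-reach (right x) = (tt , tt , refl) ◅ star-right (root-reach x)

treeGraph-isTree : ∀ t → IsTree (treeGraph t)
treeGraph-isTree t =
  (λ u v → ≡.subst₂ (Reach _ _) (encode-decode {t} u) (encode-decode {t} v)
    (star⇒reach {t} tt (star-sym (λ _ → ⊤) (root-reach (decode u)) ◅◅ root-reach (decode v)))) ,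
  unique-parent⇒acyclic (treeGraph t) (level ∘ decode {t})
    (λ u v → link-comparable (decode {t} u) (decode v))
    (λ u v w e f p q → ≡.trans (≡.sym (encode-decode {t} v))
      (≡.trans (cong encode (link-unique-parent (decode {t} u) (decode v) (decode w) e f p q)) (encode-decode {t} w)))

-- From carvings to tree decompositions

indicator : ∀ {n} → (Fin n → Bool) → Fin n → ℕ
indicator p u = if p u then 1 else 0

count≡length-filter : ∀ {n} (p : Fin n → Bool) →
  count p ≡ length (filter (λ u → p u Bool.≟ true) (allFin n))
count≡length-filter {n} p = go (allFin n)
  where
  go : ∀ xs → sum (List.map (indicator p) xs) ≡ length (filter (λ u → p u Bool.≟ true) xs)
  go [] = refl
  go (x ∷ xs) with p x
  ... | true  = cong suc (go xs)
  ... | false = go xs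

count≤length : ∀ {n} (p : Fin n → Bool) L → (∀ v → p v ≡ true → v ∈ L) → count p ≤ length L
count≤length {n} p L p⊆L = go (allFin n) L (allFin⁺ n) λ v _ → p⊆L v
  where
  go : ∀ xs L → Unique xs → (∀ v → v ∈ xs → p v ≡ true → v ∈ L) → sum (List.map (indicator p) xs) ≤ length L
  go [] L _ _ = z≤n
  go (x ∷ xs) L (x∉ ∷ u) ⊆L with p x in eq
  ... | false = go xs L u λ v v∈ → ⊆L v (there v∈)
  -- Each counted `x` uses up an entry of `L`: all its copies are deleted before the recursive call.
  ... | true  = ≤-trans
    (s≤s (go xs (filter (λ z → ¬? (x Fin.≟ z)) L) u
      λ v v∈ pv → ∈-filter⁺ (λ z → ¬? (x Fin.≟ z)) (⊆L v (there v∈) pv) (All.lookup x∉ v∈)))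
    (filter-notAll _ L (Any.map (λ x≡z x≢z → x≢z x≡z) (⊆L x (here refl) eq)))

count-positive : ∀ {n} (p : Fin n → Bool) v → p v ≡ true → 1 ≤ count p
count-positive {n} p v pv = go (∈-allFin v)
  where
  go : ∀ {xs} → v ∈ xs → 1 ≤ sum (List.map (indicator p) xs)
  go (here refl) rewrite pv = s≤s z≤n
  go {x ∷ _} (there v∈) = ≤-trans (go v∈) (m≤n+m _ (indicator p x))

count-disjoint : ∀ {n} (p q r : Fin n → Bool) → (∀ v → p v ≡ true → r v ≡ true × q v ≡ false) →
  (∀ v → q v ≡ true → r v ≡ true) → count p + count q ≤ count r
count-disjoint {n} p q r p⊆ q⊆ = go (allFin n)
  where
  pointwise : ∀ v → indicator p v + indicator q v ≤ indicator r v
  pointwise v with p v in pv | q v in qv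
  ... | false | false = z≤n
  ... | false | true rewrite q⊆ v qv = ≤-refl
  ... | true  | false rewrite proj₁ (p⊆ v pv) = ≤-refl
  ... | true  | true with () ← ≡.trans (≡.sym (proj₂ (p⊆ v pv))) qv
  go : ∀ xs → sum (List.map (indicator p) xs) + sum (List.map (indicator q) xs) ≤ sum (List.map (indicator r) xs)
  go [] = z≤n
  go (x ∷ xs) = begin
    (a + sa) + (b + sb) ≡⟨ +-assoc a sa (b + sb) ⟩
    a + (sa + (b + sb)) ≡⟨ cong (a +_) (≡.sym (+-assoc sa b sb)) ⟩
    a + ((sa + b) + sb) ≡⟨ cong (λ t → a + (t + sb)) (+-comm sa b) ⟩
    a + ((b + sa) + sb) ≡⟨ cong (a +_) (+-assoc b sa sb) ⟩
    a + (b + (sa + sb)) ≡⟨ ≡.sym (+-assoc a b (sa + sb)) ⟩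
    (a + b) + (sa + sb) ≤⟨ +-mono-≤ (pointwise x) (go xs) ⟩
    indicator r x + sum (List.map (indicator r) xs) ∎
    where
    open ≤-Reasoning
    a = indicator p x
    b = indicator q x
    sa = sum (List.map (indicator p) xs)
    sb = sum (List.map (indicator q) xs)

length-concatMap-≤ : ∀ {A B : Set} (f : A → List B) k → (∀ x → length (f x) ≤ k) →
  ∀ xs → length (concatMap f xs) ≤ length xs * k
length-concatMap-≤ f k f≤ [] = z≤n
length-concatMap-≤ f k f≤ (x ∷ xs) rewrite length-++ (f x) {concatMap f xs} =
  +-mono-≤ (f≤ x) (length-concatMap-≤ f k f≤ xs)

length-++-≤ : ∀ {A : Set} (xs : List A) {ys a b} → length xs ≤ a → length ys ≤ b → length (xs ++ ys) ≤ a + b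
length-++-≤ xs {ys} p q rewrite length-++ xs {ys} = +-mono-≤ p q

∈⇒≤-foldr-⊔ : ∀ {x xs} → x ∈ xs → x ≤ foldr _⊔_ 0 xs
∈⇒≤-foldr-⊔ (here refl)         = m≤m⊔n _ _
∈⇒≤-foldr-⊔ {xs = y ∷ _} (there x∈) = ≤-trans (∈⇒≤-foldr-⊔ x∈) (m≤n⊔m y _)

record Split {n} (U U₁ U₂ : Fin n → Bool) : Set where
  field
    union    : ∀ v → U v ≡ U₁ v ∨ U₂ v
    disjoint : ∀ v → U₁ v ≡ true → U₂ v ≡ false
open Split

split-swap : ∀ {n} {U U₁ U₂ : Fin n → Bool} → Split U U₁ U₂ → Split U U₂ U₁
split-swap {U₁ = U₁} {U₂} σ = record
  { union    = λ v → ≡.trans (union σ v) (Bool.∨-comm (U₁ v) (U₂ v))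
  ; disjoint = disjoint₂
  }
  where
  disjoint₂ : ∀ v → U₂ v ≡ true → U₁ v ≡ false
  disjoint₂ v v∈₂ with U₁ v in eq
  ... | false = refl
  ... | true  = ≡.trans (≡.sym v∈₂) (disjoint σ v eq)

module _ {n} (G : Graph n) where

  neighbours : Fin n → List (Fin n)
  neighbours v = filter (λ u → adj G v u Bool.≟ true) (allFin n)

  ∈-neighbours : ∀ {v u} → adj G v u ≡ true → u ∈ neighbours v
  ∈-neighbours e = ∈-filter⁺ _ (∈-allFin _) e

  length-neighbours : ∀ v → length (neighbours v) ≤ maxDegree G
  length-neighbours v rewrite ≡.sym (count≡length-filter (adj G v)) =
    ∈⇒≤-foldr-⊔ (∈-map⁺ (degree G) (∈-allFin v))

  Boundary : (Fin n → Bool) → Fin n → Set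
  Boundary U v = ∃ λ w → adj G v w ≡ true × U v ≢ U w

  boundary? : ∀ U v → Dec (Boundary U v)
  boundary? U v = any? λ w → (adj G v w Bool.≟ true) ×-dec ¬? (U v Bool.≟ U w)

  -- `H` is a vertex cover of the edge cut between `U` and its complement.
  CutHit : ℕ → (Fin n → Bool) → Set
  CutHit h U = ∃ λ H → length H ≤ h ×
    (∀ u v → adj G u v ≡ true → U u ≢ U v → u ∈ H ⊎ v ∈ H)

  -- A hierarchical bipartition as in carving decompositions, with each cut measured by a vertex
  -- cover. Tips may be empty.
  data Carving (h : ℕ) : (Fin n → Bool) → Set where
    tip  : ∀ {U} → (∀ u v → U u ≡ true → U v ≡ true → u ≡ v) → Carving h U
    fork : ∀ {U U₁ U₂} → Split U U₁ U₂ → CutHit h U₁ → CutHit h U₂ →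
           Carving h U₁ → Carving h U₂ → Carving h U

  shape : ∀ {h U} → Carving h U → Shape
  shape (tip _)              = leaf
  shape (fork _ _ _ c₁ c₂) = node (shape c₁) (shape c₂)

  -- A vertex v is placed on all tree paths that join its tip to the tips of its neighbours.
  Bag : ∀ {h U} (c : Carving h U) → Node (shape c) → Fin n → Set
  Bag {U = U} (tip _) root v = U v ≡ true ⊎ Boundary U v
  Bag (fork {U₁ = U₁} {U₂} _ _ _ _ _) root v = Boundary U₁ v ⊎ Boundary U₂ v
  Bag (fork _ _ _ c₁ c₂) (left t)  v = Bag c₁ t v
  Bag (fork _ _ _ c₁ c₂) (right t) v = Bag c₂ t v

  bag? : ∀ {h U} (c : Carving h U) t v → Dec (Bag c t v)
  bag? {U = U} (tip _) root v = (U v Bool.≟ true) ⊎-dec boundary? U v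
  bag? (fork {U₁ = U₁} {U₂} _ _ _ _ _) root v = boundary? U₁ v ⊎-dec boundary? U₂ v
  bag? (fork _ _ _ c₁ c₂) (left t)  v = bag? c₁ t v
  bag? (fork _ _ _ c₁ c₂) (right t) v = bag? c₂ t v

  -- If neither half separated the ends of an edge, their union would not separate them either.
  boundary⇒root : ∀ {h U} (c : Carving h U) {v} → Boundary U v → Bag c root v
  boundary⇒root (tip _) b = inj₂ b
  boundary⇒root (fork {U₁ = U₁} {U₂} σ _ _ _ _) {v} (w , e , ne) with U₁ v Bool.≟ U₁ w
  ... | no ne₁ = inj₁ (w , e , ne₁)
  ... | yes eq₁ = inj₂ (w , e , λ eq₂ → ne (≡.trans (union σ v) (≡.trans (≡.cong₂ _∨_ eq₁ eq₂) (≡.sym (union σ w)))))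

  module _ {U U₁ U₂ : Fin n → Bool} (σ : Split U U₁ U₂) where

    boundary₁⇒boundary : ∀ {v} → U v ≡ false → Boundary U₁ v → Boundary U v
    boundary₁⇒boundary {v} v∉ (w , e , ne) = w , e , λ eq →
      ne (≡.trans (false₁ v v∉) (≡.sym (false₁ w (≡.trans (≡.sym eq) v∉))))
      where
      false₁ : ∀ u → U u ≡ false → U₁ u ≡ false
      false₁ u u∉ with U₁ u | union σ u
      ... | false | _  = refl
      ... | true  | eq = ≡.trans (≡.sym eq) u∉

    boundary₂⇒boundary₁ : ∀ {v} → U₁ v ≡ true → Boundary U₂ v → Boundary U₁ v
    boundary₂⇒boundary₁ {v} v∈ (w , e , ne) = w , e , λ eq →
      ne (≡.trans (disjoint σ v v∈) (≡.sym (disjoint σ w (≡.trans (≡.sym eq) v∈))))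

  -- A vertex outside `U` gets into these bags only through edges that enter `U`. Such an edge
  -- crosses every set from that of `t` up to `U`, so all bags on the way to the root contain `v`.
  outside : ∀ {h U} (c : Carving h U) {v} → U v ≡ false → ∀ t → Bag c t v →
    Boundary U v × Star (Step (λ s → Bag c s v)) t root
  outside (tip _) v∉ root (inj₁ v∈) with () ← ≡.trans (≡.sym v∉) v∈
  outside (tip _) v∉ root (inj₂ b) = b , ε
  outside (fork σ _ _ c₁ c₂) v∉ root (inj₁ b) = boundary₁⇒boundary σ v∉ b , ε
  outside (fork σ _ _ c₁ c₂) v∉ root (inj₂ b) =
    boundary₁⇒boundary (split-swap σ) v∉ b , ε
  outside (fork {U₁ = U₁} σ _ _ c₁ c₂) {v} v∉ (left t) b
    with b₁ , p ← outside c₁ (Bool.∨-conicalˡ _ _ (≡.trans (≡.sym (union σ v)) v∉)) t b =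
    boundary₁⇒boundary σ v∉ b₁ ,
    star-left p ◅◅ (boundary⇒root c₁ b₁ , inj₁ b₁ , refl) ◅ ε
  outside (fork {U₁ = U₁} σ _ _ c₁ c₂) {v} v∉ (right t) b
    with b₂ , p ← outside c₂ (Bool.∨-conicalʳ (U₁ v) _ (≡.trans (≡.sym (union σ v)) v∉)) t b =
    boundary₁⇒boundary (split-swap σ) v∉ b₂ ,
    star-right p ◅◅ (boundary⇒root c₂ b₂ , inj₂ b₂ , refl) ◅ ε

  -- `ℓ` is the tip that holds `v`. Its bag also holds the neighbours of `v`, since their edges to
  -- `v` cross the cut of the tip. Joining every bag of `v` to `ℓ` makes these bags connected.
  inside : ∀ {h U} (c : Carving h U) {v} → U v ≡ true → ∃ λ ℓ →
    Bag c ℓ v × (∀ u → adj G u v ≡ true → Bag c ℓ u) ×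
    (∀ t → Bag c t v → Star (Step (λ s → Bag c s v)) t ℓ)
  inside {U = U} (tip ≤1) {v} v∈ = root , inj₁ v∈ , near , λ { root _ → ε }
    where
    near : ∀ u → adj G u v ≡ true → U u ≡ true ⊎ Boundary U u
    near u e = inj₂ (v , e , λ eq → loop (≤1 u v (≡.trans eq v∈) v∈))
      where
      loop : u ≢ v
      loop refl with () ← ≡.trans (≡.sym e) (irrefl G v)
  inside (fork {U₁ = U₁} {U₂} σ _ _ c₁ c₂) {v} v∈ with U₁ v in v∈₁
  ... | true with ℓ , bℓ , near , paths ← inside c₁ v∈₁ = left ℓ , bℓ , near , λ where
          root (inj₁ b) → down b
          root (inj₂ b) → down (boundary₂⇒boundary₁ σ v∈₁ b)
          (left t) b → star-left (paths t b)
          -- From the other branch the walk climbs to the fork and then descends to `ℓ`. An edge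
          -- from `v` into `U₂` also leaves `U₁`, so `v` stays in the bags.
          (right t) b → let b₂ , p = outside c₂ (disjoint σ v v∈₁) t b in
            star-right p ◅◅ (boundary⇒root c₂ b₂ , inj₂ b₂ , refl) ◅ down (boundary₂⇒boundary₁ σ v∈₁ b₂)
        where
        down : Boundary U₁ v → Star (Step _) root (left ℓ)
        down b = (inj₁ b , boundary⇒root c₁ b , refl) ◅ star-left (paths root (boundary⇒root c₁ b))
  ... | false with v∈₂ ← ≡.trans (cong (_∨ U₂ v) (≡.sym v∈₁)) (≡.trans (≡.sym (union σ v)) v∈)
              with ℓ , bℓ , near , paths ← inside c₂ v∈₂ = right ℓ , bℓ , near , λ where
          root (inj₁ b) → down (boundary₂⇒boundary₁ (split-swap σ) v∈₂ b)
          root (inj₂ b) → down b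
          (left t) b → let b₁ , p = outside c₁ v∈₁ t b in
            star-left p ◅◅ (boundary⇒root c₁ b₁ , inj₁ b₁ , refl) ◅
              down (boundary₂⇒boundary₁ (split-swap σ) v∈₂ b₁)
          (right t) b → star-right (paths t b)
        where
        down : Boundary U₂ v → Star (Step _) root (right ℓ)
        down b = (inj₂ b , boundary⇒root c₂ b , refl) ◅ star-right (paths root (boundary⇒root c₂ b))

  closedNeighbourhood : List (Fin n) → List (Fin n)
  closedNeighbourhood = concatMap λ z → z ∷ neighbours z

  length-closedNeighbourhood : ∀ {h} H → length H ≤ h → length (closedNeighbourhood H) ≤ h * suc (maxDegree G)
  length-closedNeighbourhood H H≤ = ≤-trans
    (length-concatMap-≤ _ _ (λ z → s≤s (length-neighbours z)) H)
    (*-monoˡ-≤ (suc (maxDegree G)) H≤)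

  -- A boundary vertex is in the hitting set or adjacent to a member of it. This costs a factor
  -- `suc (maxDegree G)` in the width.
  boundary⊆closedNeighbourhood : ∀ {h U v} ((H , _) : CutHit h U) → Boundary U v → v ∈ closedNeighbourhood H
  boundary⊆closedNeighbourhood {v = v} (H , _ , hits) (w , e , ne) with hits v w e ne
  ... | inj₁ v∈ = ∈-concatMap⁺ _ (Any.map (λ { refl → here refl }) v∈)
  ... | inj₂ w∈ = ∈-concatMap⁺ _
    (Any.map (λ { refl → there (∈-neighbours (≡.trans (sym G w v) e)) }) w∈)

  module _ {h w : ℕ} (h-bound : (h + h) * suc (maxDegree G) ≤ suc w) (Δ≤w : maxDegree G ≤ w) where

    -- A fork bag is covered by the closed neighbourhoods of two hitting sets, a nonempty tip bag by
    -- the closed neighbourhood of one vertex.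
    bag-size : ∀ {U} (c : Carving h U) t (p : Fin n → Bool) → (∀ v → p v ≡ true → Bag c t v) → count p ≤ suc w
    bag-size (fork {U₁ = U₁} {U₂} _ cut₁@(H₁ , H₁≤ , _) cut₂@(H₂ , H₂≤ , _) _ _) root p p⊆ = ≤-trans
      (count≤length p (closedNeighbourhood H₁ ++ closedNeighbourhood H₂) (λ v pv → member (p⊆ v pv)))
      (≤-trans (length-++-≤ (closedNeighbourhood H₁)
                 (length-closedNeighbourhood H₁ H₁≤) (length-closedNeighbourhood H₂ H₂≤))
        (≤-trans (≤-reflexive (≡.sym (*-distribʳ-+ (suc (maxDegree G)) h h))) h-bound))
      where
      member : ∀ {v} → Boundary U₁ v ⊎ Boundary U₂ v → v ∈ closedNeighbourhood H₁ ++ closedNeighbourhood H₂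
      member (inj₁ b) = ∈-++⁺ˡ (boundary⊆closedNeighbourhood cut₁ b)
      member (inj₂ b) = ∈-++⁺ʳ (closedNeighbourhood H₁) (boundary⊆closedNeighbourhood cut₂ b)
    bag-size (fork _ _ _ c₁ c₂) (left t)  = bag-size c₁ t
    bag-size (fork _ _ _ c₁ c₂) (right t) = bag-size c₂ t
    bag-size (tip {U} ≤1) root p p⊆ with any? (λ v → U v Bool.≟ true)
    ... | yes (v , v∈) = ≤-trans (count≤length p (v ∷ neighbours v) (λ u pu → member u (p⊆ u pu)))
                           (s≤s (≤-trans (length-neighbours v) Δ≤w))
      where
      member : ∀ u → U u ≡ true ⊎ Boundary U u → u ∈ v ∷ neighbours v
      member u (inj₁ u∈) = here (≤1 u v u∈ v∈)
      member u (inj₂ (x , e , ne)) with U u in u∈ | U x in x∈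
      ... | true  | _     = here (≤1 u v u∈ v∈)
      ... | false | true with refl ← ≤1 x v x∈ v∈ = there (∈-neighbours (≡.trans (sym G x u) e))
      ... | false | false = contradiction refl ne
    ... | no none = ≤-trans (count≤length p [] (λ u pu → ⊥-elim (empty u (p⊆ u pu)))) z≤n
      where
      empty : ∀ u → ¬ (U u ≡ true ⊎ Boundary U u)
      empty u (inj₁ u∈) = none (u , u∈)
      empty u (inj₂ (x , e , ne)) with U u in u∈ | U x in x∈
      ... | true  | _     = none (u , u∈)
      ... | false | true  = none (x , x∈)
      ... | false | false = ne refl

    carving⇒treeDecomposition : ∀ {U} → Carving h U → (∀ v → U v ≡ true) → TwLe G w
    carving⇒treeDecomposition c total = record
      { m = edges (shape c)
      ; tree = treeGraph (shape c)
      ; isTree = treeGraph-isTree (shape c)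
      ; bag = bag
      ; cover-vertices = λ v → let ℓ , b , _ = inside c (total v) in encode ℓ , to v ℓ b
      ; cover-edges = λ u v e → let ℓ , b , near , _ = inside c (total v) in
          encode ℓ , to u ℓ (near u e) , to v ℓ b
      ; connected-bags = λ v t t′ b b′ → ≡.subst₂ (Reach _ _) (encode-decode {shape c} t) (encode-decode {shape c} t′)
          (star⇒reach {shape c} (to v _ (from v t′ b′)) (gmap id
            (λ (sx , sy , e) → to v _ sx , to v _ sy , e)
            (let _ , _ , _ , paths = inside c (total v) in
              paths _ (from v t b) ◅◅ star-sym (λ s → Bag c s v) (paths _ (from v t′ b′)))))
      ; width≤ = λ t → bag-size c (decode t) (bag t) (λ v → from v t)
      }
      where
      bag : Fin (suc (edges (shape c))) → Fin n → Bool
      bag t v = ⌊ bag? c (decode t) v ⌋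
      from : ∀ v t → bag t v ≡ true → Bag c (decode t) v
      from v t eq with bag? c (decode t) v
      ... | yes b = b
      to : ∀ v ℓ → Bag c ℓ v → bag (encode ℓ) v ≡ true
      to v ℓ b rewrite decode-encode ℓ with bag? c ℓ v
      ... | yes _ = refl
      ... | no ¬b = contradiction b ¬b

-- Partition sequences of bounded stretch

-- At most k parts of P meet X.
Few : ∀ {n} → Partition n → ℕ → (Fin n → Set) → Set
Few {n} P k X = Σ (List (Fin n)) λ L → length L ≤ k × (∀ v → X v → Any (λ z → P z ≡ P v) L)

module _ {n} {P : Partition n} where

  few-mono : ∀ {k m} {X Y : Fin n → Set} → k ≤ m → (∀ v → Y v → X v) → Few P k X → Few P m Y
  few-mono k≤m Y⊆X (L , L≤ , covers) = L , ≤-trans L≤ k≤m , λ v → covers v ∘ Y⊆X v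

  few-∪ : ∀ {k m} {X Y Z : Fin n → Set} → (∀ v → Z v → X v ⊎ Y v) → Few P k X → Few P m Y → Few P (k + m) Z
  few-∪ Z⊆ (L , L≤ , covers) (M , M≤ , covers′) = L ++ M , length-++-≤ L L≤ M≤ ,
    λ v z → [ Any.++⁺ˡ ∘ covers v , Any.++⁺ʳ L ∘ covers′ v ]′ (Z⊆ v z)

  few-∅ : ∀ {k} {X : Fin n → Set} → (∀ v → ¬ X v) → Few P k X
  few-∅ empty = [] , z≤n , λ v x → contradiction x (empty v)

  -- Decided greedily: pick a vertex of `X`, discard its part and continue with one part less.
  few? : ∀ {X : Fin n → Set} → Decidable X → ∀ k → Dec (Few P k X)
  few? X? k with any? X?
  ... | no none = yes (few-∅ λ v x → none (v , x))
  few? X? zero | yes (v , x) = no λ { ([] , _ , covers) → contradiction (covers v x) λ () }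
  few? X? (suc k) | yes (v , x) with few? (λ w → X? w ×-dec ¬? (P w ≟ P v)) k
  ... | yes (L , L≤ , covers) = yes (v ∷ L , s≤s L≤ , λ w xw → cover w xw)
    where
    cover : ∀ w → _ → Any (λ z → P z ≡ P w) (v ∷ L)
    cover w xw with P w ≟ P v
    ... | yes w≡v = here (≡.sym w≡v)
    ... | no  w≢v = there (covers w (xw , w≢v))
  ... | no ¬few = no λ (L , L≤ , covers) → ¬few
    ( filter (λ z → ¬? (P z ≟ P v)) L
    , s≤s⁻¹ (≤-trans (filter-notAll _ L (Any.map (λ eq ne → ne eq) (covers v x))) L≤)
    , λ w (xw , w≢v) → let z , z∈ , z≡w = find (covers w xw) in
        lose (∈-filter⁺ (λ z → ¬? (P z ≟ P v)) z∈ (w≢v ∘ ≡.trans (≡.sym z≡w))) z≡w )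

-- Undoing a merge splits one part. Representatives of both pieces join the list, which is the
-- source of `2 +` in later bounds.
few-refine : ∀ {n} {P Q : Partition n} {k X} → MergeOf P Q → Few Q k X → Few P (2 + k) X
few-refine {P = P} {Q} (x , y , _ , merge) (L , L≤ , covers) = x ∷ y ∷ L , s≤s (s≤s L≤) , λ v xv →
  let z , z∈ , z≡v = find (covers v xv) in cover v z∈ (proj₁ (merge z v) z≡v)
  where
  cover : ∀ v {z} → z ∈ L → P z ≡ P v ⊎ (P z ≡ P x × P v ≡ P y) ⊎ (P z ≡ P y × P v ≡ P x) →
    Any (λ z → P z ≡ P v) (x ∷ y ∷ L)
  cover v z∈ (inj₁ z≡v)              = there (there (lose z∈ z≡v))
  cover v z∈ (inj₂ (inj₁ (_ , v≡y))) = there (here (≡.sym v≡y))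
  cover v z∈ (inj₂ (inj₂ (_ , v≡x))) = here (≡.sym v≡x)

-- An interval meeting more than threshold s parts has two subintervals that each
-- meet more than s + 1 parts.
threshold : ℕ → ℕ
threshold s = suc (suc s) + suc s

-- `D` bounds the number of vertices in the small parts that meet an interval with at most
-- `2 + threshold s` parts. Each end of the interval adds a hitting set of size `ℓ * D`.
cutSize : ℕ → ℕ → ℕ → ℕ
cutSize Δ s ℓ = D + (ℓ * D + ℓ * D) where D = (2 + threshold s) * Δ

-- Dead edges and small parts

module _ {n} (G : Graph n) where

  -- Such a part has at most maxDegree G vertices.
  Small : Partition n → Fin n → Set
  Small P u = ∃ λ v → ∀ w → P w ≡ P u → adj G v w ≡ true

  small? : ∀ P u → Dec (Small P u)
  small? P u = any? λ v → all? λ w → (P w ≟ P u) →-dec (adj G v w Bool.≟ true)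

  inhomogeneous-sym : ∀ {P u v} → Inhomogeneous G P u v → Inhomogeneous G P v u
  inhomogeneous-sym (ne , u , u′ , v , v′ , pu , pu′ , pv , pv′ , e , ¬e) =
    ne ∘ ≡.sym , v , v′ , u , u′ , pv , pv′ , pu , pu′ ,
    ≡.trans (sym G v u) e , ≡.trans (sym G v′ u′) ¬e

  nbhd-sym : ∀ {P u v} → ClosedNbhdUnion G P u v → ClosedNbhdUnion G P v u
  nbhd-sym = map ≡.sym inhomogeneous-sym

  -- Witnesses of inhomogeneity survive when parts grow, unless the two parts fuse. So dead edges
  -- stay dead under merging, and good cuts stay good under refinement.
  nbhd-merge : ∀ {P Q u v} → MergeOf P Q → ClosedNbhdUnion G P u v → ClosedNbhdUnion G Q u v
  nbhd-merge (_ , _ , _ , merge) (inj₁ v≡u) = inj₁ (proj₂ (merge _ _) (inj₁ v≡u))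
  nbhd-merge {Q = Q} {u} {v} (_ , _ , _ , merge) (inj₂ (_ , a , a′ , b , b′ , pa , pa′ , pb , pb′ , e , ¬e))
    with Q v ≟ Q u
  ... | yes v≡u = inj₁ v≡u
  ... | no  v≢u = inj₂ (v≢u ∘ ≡.sym , a , a′ , b , b′ , coarsen pa , coarsen pa′ , coarsen pb , coarsen pb′ , e , ¬e)
    where
    coarsen = λ {a} {b} eq → proj₂ (merge a b) (inj₁ eq)

  -- For an edge `uv`, `ClosedNbhdUnion G P u v` says that it is dead. If it is not, the parts of
  -- `u` and `v` are homogeneous, so `v` is adjacent to the whole part of `u`.
  nbhd-or-small : ∀ P {u v} → adj G u v ≡ true → ClosedNbhdUnion G P u v ⊎ Small P u
  nbhd-or-small P {u} {v} e with P v ≟ P u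
  ... | yes v≡u = inj₁ (inj₁ v≡u)
  ... | no  v≢u with any? (λ w → (P w ≟ P u) ×-dec (adj G w v Bool.≟ false))
  ... | yes (w , w≡u , ¬e) = inj₁ (inj₂ (v≢u ∘ ≡.sym , u , w , v , v , refl , w≡u , refl , refl , e , ¬e))
  ... | no none = inj₂ (v , λ w w≡u → ≡.trans (sym G v w) (Bool.¬-not λ ¬e → none (w , w≡u , ¬e)))

  ¬nbhd-singletons : ∀ {P u v} → Singletons P → adj G u v ≡ true → ¬ ClosedNbhdUnion G P u v
  ¬nbhd-singletons inj e (inj₁ v≡u) with refl ← inj v≡u with () ← ≡.trans (≡.sym e) (irrefl G _)
  ¬nbhd-singletons inj _ (inj₂ (_ , a , a′ , b , b′ , pa , pa′ , pb , pb′ , e , ¬e))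
    with refl ← inj pa | refl ← inj pa′ | refl ← inj pb | refl ← inj pb′ with () ← ≡.trans (≡.sym e) ¬e

  few⇒small-list : ∀ {P k X} → Few P k X →
    ∃ λ H → length H ≤ k * maxDegree G × (∀ u → X u → Small P u → u ∈ H)
  few⇒small-list {P} {k} (L , L≤ , covers) = concatMap part L ,
    ≤-trans (length-concatMap-≤ part (maxDegree G) length-part L) (*-monoˡ-≤ (maxDegree G) L≤) ,
    λ u xu small → ∈-concatMap⁺ part (Any.map (∈-part small) (covers u xu))
    where
    part : Fin n → List (Fin n)
    part z with small? P z
    ... | yes (v , _) = neighbours G v
    ... | no _        = []
    length-part : ∀ z → length (part z) ≤ maxDegree G
    length-part z with small? P z
    ... | yes (v , _) = length-neighbours G v
    ... | no _        = z≤n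
    ∈-part : ∀ {u z} → Small P u → P z ≡ P u → u ∈ part z
    ∈-part {u} {z} (v , sees) z≡u with small? P z
    -- The decision may return a witness `w` other than `v`, but its neighbourhood contains the
    -- whole part as well.
    ... | yes (w , sees′) = ∈-neighbours G (sees′ u (≡.sym z≡u))
    ... | no ¬small = contradiction (v , λ w w≡z → sees w (≡.trans w≡z z≡u)) ¬small

  -- Intervals of the order and cuts at positions

  module _ (pos : Fin n → ℕ) where

    In : ℕ → ℕ → Fin n → Set
    In a b v = a ≤ pos v × pos v < b

    in? : ∀ a b → Decidable (In a b)
    in? a b v = (a ≤? pos v) ×-dec (pos v <? b)

    interval : ℕ → ℕ → Fin n → Bool
    interval a b v = ⌊ in? a b v ⌋

    interval⁺ : ∀ {a b v} → In a b v → interval a b v ≡ true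
    interval⁺ {a} {b} {v} i with in? a b v
    ... | yes _ = refl
    ... | no ¬i = contradiction i ¬i

    interval⁻ : ∀ {a b} v → interval a b v ≡ true → In a b v
    interval⁻ {a} {b} v eq with in? a b v
    ... | yes i = i

    interval⁺-false : ∀ {a b v} → ¬ In a b v → interval a b v ≡ false
    interval⁺-false {a} {b} {v} ¬i with in? a b v
    ... | yes i = contradiction i ¬i
    ... | no _  = refl

    in-left : ∀ {a q b} → q ≤ b → ∀ v → In a q v → In a b v
    in-left q≤b v (a≤ , <q) = a≤ , <-≤-trans <q q≤b

    in-right : ∀ {a q b} → a ≤ q → ∀ v → In q b v → In a b v
    in-right a≤q v (q≤ , <b) = ≤-trans a≤q q≤ , <b

    in-split : ∀ {a b} q v → In a b v → In a q v ⊎ In q b v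
    in-split q v (a≤ , <b) with pos v <? q
    ... | yes <q = inj₁ (a≤ , <q)
    ... | no ≮q  = inj₂ (≮⇒≥ ≮q , <b)

    interval-split : ∀ {a q b} → a ≤ q → q ≤ b → Split (interval a b) (interval a q) (interval q b)
    interval-split {a} {q} {b} a≤q q≤b = record { union = union′ ; disjoint = disjoint′ }
      where
      disjoint′ : ∀ v → interval a q v ≡ true → interval q b v ≡ false
      disjoint′ v v∈ = interval⁺-false λ (q≤ , _) → <⇒≱ (proj₂ (interval⁻ {a} v v∈)) q≤
      union′ : ∀ v → interval a b v ≡ interval a q v ∨ interval q b v
      union′ v with in? a b v
      ... | yes i with in-split q v i
      ...   | inj₁ i₁ rewrite interval⁺ i₁ = refl
      ...   | inj₂ i₂ rewrite interval⁺ i₂ = ≡.sym (Bool.∨-zeroʳ _)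
      union′ v | no ¬i
        rewrite interval⁺-false {a} {q} {v} (¬i ∘ in-left q≤b v)
              | interval⁺-false {q} {b} {v} (¬i ∘ in-right a≤q v) = refl

    size : ℕ → ℕ → ℕ
    size a b = count (interval a b)

    size-split : ∀ {a q b} → a ≤ q → q ≤ b → size a q + size q b ≤ size a b
    size-split {a} {q} {b} a≤q q≤b = count-disjoint (interval a q) (interval q b) (interval a b)
      (λ v v∈ → interval⁺ (in-left q≤b v (interval⁻ v v∈)) , Split.disjoint (interval-split a≤q q≤b) v v∈)
      (λ v v∈ → interval⁺ (in-right a≤q v (interval⁻ v v∈)))

    -- Position `q` stands for the gap just before it; only the dead edges across this gap have to
    -- be hit.
    GoodCut : Partition n → ℕ → ℕ → Set
    GoodCut P q h = ∃ λ H → length H ≤ h × (∀ u v → adj G u v ≡ true → pos u < q → q ≤ pos v →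
      ClosedNbhdUnion G P u v → u ∈ H ⊎ v ∈ H)

    goodCut-mono : ∀ {P q h k} → h ≤ k → GoodCut P q h → GoodCut P q k
    goodCut-mono h≤k (H , H≤ , hits) = H , ≤-trans H≤ h≤k , hits

    goodCut-refine : ∀ {P Q q h} → MergeOf P Q → GoodCut Q q h → GoodCut P q h
    goodCut-refine merge (H , H≤ , hits) =
      H , H≤ , λ u v e <q q≤ c → hits u v e <q q≤ (nbhd-merge merge c)

    goodCut-singletons : ∀ {P q h} → Singletons P → GoodCut P q h
    goodCut-singletons single = [] , z≤n , λ u v e _ _ c → contradiction c (¬nbhd-singletons single e)

    -- A dead edge of `Q` across `q` has an end in the interval. If it is dead for `P` too, `H` hits
    -- it; otherwise that end lies in one of the few small parts of `P` collected in `A`.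
    goodCut-coarsen : ∀ {P Q q h k a b} → Few P k (In a b) → GoodCut P q h →
      (∀ u v → pos u < q → q ≤ pos v → ClosedNbhdUnion G Q u v → In a b u ⊎ In a b v) →
      GoodCut Q q (k * maxDegree G + h)
    goodCut-coarsen {P} {Q} {q} {h} few (H , H≤ , hits) touches with few⇒small-list few
    ... | A , A≤ , covers = A ++ H , length-++-≤ A A≤ H≤ , hit
      where
      hit : ∀ u v → adj G u v ≡ true → pos u < q → q ≤ pos v → ClosedNbhdUnion G Q u v → u ∈ A ++ H ⊎ v ∈ A ++ H
      hit u v e <q q≤ c with touches u v <q q≤ c
      ... | inj₁ iu with nbhd-or-small P e
      ...   | inj₁ c′    = map (∈-++⁺ʳ A) (∈-++⁺ʳ A) (hits u v e <q q≤ c′)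
      ...   | inj₂ small = inj₁ (∈-++⁺ˡ (covers u iu small))
      hit u v e <q q≤ c | inj₂ iv with nbhd-or-small P (≡.trans (sym G v u) e)
      ...   | inj₁ c′    = map (∈-++⁺ʳ A) (∈-++⁺ʳ A) (hits u v e <q q≤ (nbhd-sym c′))
      ...   | inj₂ small = inj₂ (∈-++⁺ˡ (covers v iv small))

    -- If the inner end of a leaving edge is in a small part, `A` hits the edge. Otherwise the edge
    -- is dead and crosses `a` or `b`, where `H` or `H′` hits it.
    interval-cutHit : ∀ {P k h a b} → Few P k (In a b) → GoodCut P a h → GoodCut P b h →
      CutHit G (k * maxDegree G + (h + h)) (interval a b)
    interval-cutHit {P} {k} {h} {a} {b} few (H , H≤ , hits) (H′ , H′≤ , hits′) with few⇒small-list few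
    ... | A , A≤ , covers = all , length-++-≤ A A≤ (length-++-≤ H H≤ H′≤) , hit
      where
      all = A ++ H ++ H′
      leaving : ∀ u v → adj G u v ≡ true → In a b u → ¬ In a b v → u ∈ all ⊎ v ∈ all
      leaving u v e iu@(a≤ , <b) ¬iv with nbhd-or-small P e
      ... | inj₂ small = inj₁ (∈-++⁺ˡ (covers u iu small))
      ... | inj₁ c with pos v <? a
      ...   | yes <a = Sum.swap (map (∈-++⁺ʳ A ∘ ∈-++⁺ˡ) (∈-++⁺ʳ A ∘ ∈-++⁺ˡ)
                         (hits v u (≡.trans (sym G v u) e) <a a≤ (nbhd-sym c)))
      ...   | no ≮a = map (∈-++⁺ʳ A ∘ ∈-++⁺ʳ H) (∈-++⁺ʳ A ∘ ∈-++⁺ʳ H)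
                        (hits′ u v e <b (≮⇒≥ λ <b′ → ¬iv (≮⇒≥ ≮a , <b′)) c)
      hit : ∀ u v → adj G u v ≡ true → interval a b u ≢ interval a b v → u ∈ all ⊎ v ∈ all
      hit u v e ne with in? a b u | in? a b v
      ... | yes iu | no ¬iv = leaving u v e iu ¬iv
      ... | no ¬iu | yes iv = Sum.swap (leaving v u (≡.trans (sym G v u) e) iv ¬iu)
      ... | yes _  | yes _  = contradiction refl ne
      ... | no _   | no _   = contradiction refl ne

    -- The closed red neighbourhood of the part of `u` spans from `u` to `v`, so every other part
    -- meeting the interval interferes with that part. The extra one is the part of `u` itself.
    nbhd-spans-few : ∀ {P s} → (∀ u → StretchLe G pos P u s) → ∀ {u v} → ClosedNbhdUnion G P u v →
      ∀ {a b} → pos u < a → b ≤ pos v → Few P (suc s) (In a b)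
    nbhd-spans-few {P} stretch {u} {v} c <a b≤ with stretch u
    ... | L , L≤ , covers = u ∷ L , s≤s L≤ , cover
      where
      cover : ∀ w → _ → Any (λ z → P z ≡ P w) (u ∷ L)
      cover w (a≤ , <b) with P w ≟ P u
      ... | yes w≡u = here (≡.sym w≡u)
      ... | no  w≢u = there (covers w (w≢u , w , (w , w , refl , refl , ≤-refl , ≤-refl) ,
                       (u , v , inj₁ refl , c , ≤-trans (<⇒≤ <a) a≤ , ≤-trans (<⇒≤ <b) b≤)))

    nbhd-touches : ∀ {P s} → (∀ u → StretchLe G pos P u s) → ∀ {a b} → ¬ Few P (suc s) (In a b) →
      ∀ {q} → a < q → q < b → ∀ u v → pos u < q → q ≤ pos v → ClosedNbhdUnion G P u v → In a b u ⊎ In a b v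
    nbhd-touches stretch {a} {b} ¬few a<q q<b u v <q q≤ c with pos u <? a | pos v <? b
    ... | no ≮a  | _      = inj₁ (≮⇒≥ ≮a , <-trans <q q<b)
    ... | yes _  | yes <b = inj₂ (≤-trans (<⇒≤ a<q) q≤ , <b)
    ... | yes <a | no ≮b  = contradiction (nbhd-spans-few stretch c <a (≮⇒≥ ≮b)) ¬few

    ¬few⇒< : ∀ {P k a b} → ¬ Few P k (In a b) → a < b
    ¬few⇒< ¬few = ≰⇒> λ b≤a → ¬few (few-∅ λ v (a≤ , <b) → <⇒≱ <b (≤-trans b≤a a≤))

    bound : ℕ
    bound = suc (foldr _⊔_ 0 (List.map pos (allFin n)))

    pos<bound : ∀ v → pos v < bound
    pos<bound v = s≤s (∈⇒≤-foldr-⊔ (∈-map⁺ pos (∈-allFin v)))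

    module _ (pos-injective : Injective _≡_ _≡_ pos) where

      in-unique : ∀ {x y} → y ≤ suc x → ∀ u v → In x y u → In x y v → u ≡ v
      in-unique {x} {y} y≤ u v iu iv = pos-injective (≡.trans (at u iu) (≡.sym (at v iv)))
        where
        at : ∀ u → In x y u → pos u ≡ x
        at u (x≤ , <y) = ≤-antisym (s≤s⁻¹ (≤-trans <y y≤)) x≤

      few-unit : ∀ {P x y k} → y ≤ suc x → Few P (suc k) (In x y)
      few-unit {x = x} {y} y≤ with any? (in? x y)
      ... | no none     = few-∅ λ v i → none (v , i)
      ... | yes (u , i) = u ∷ [] , s≤s z≤n , λ v j → here (cong _ (in-unique y≤ u v i j))

      ¬few⇒1+< : ∀ {P k a b} → ¬ Few P (suc k) (In a b) → suc a < b
      ¬few⇒1+< ¬few = ≰⇒> λ b≤ → ¬few (few-unit b≤)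

      -- Sweep `x` to the right until `[a, x)` first meets more than `k` parts. The last position
      -- holds at most one vertex, so `[a, x)` meets at most `k + 1` parts and `[x, b)` more than
      -- `m`.
      few-split : ∀ P k m {a b} → ¬ Few P (suc k + m) (In a b) →
        ∃ λ x → ¬ Few P k (In a x) × ¬ Few P m (In x b)
      few-split P k m {a} {b} ¬few = search b a (m≤n+m b a) (few-∅ λ v (a≤ , <a) → <⇒≱ <a a≤)
        where
        search : ∀ f x → b ≤ x + f → Few P k (In a x) → ∃ λ x → ¬ Few P k (In a x) × ¬ Few P m (In x b)
        search zero x b≤ few rewrite +-identityʳ x = contradiction
          (few-mono (≤-trans (n≤1+n k) (m≤m+n (suc k) m)) (in-left b≤) few) ¬few
        search (suc f) x b≤ few with few? (in? a (suc x)) k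
        ... | yes few′ = search f (suc x) (≤-trans b≤ (≤-reflexive (+-suc x f))) few′
        ... | no ¬few′ = suc x , ¬few′ , λ few″ → ¬few
          (few-∪ (in-split (suc x))
            (few-mono (≤-reflexive (+-comm k 1)) (λ _ i → i) (few-∪ (in-split x) few (few-unit ≤-refl))) few″)

      -- Finding good cuts and carving the order

      module _ (1≤n : 1 ≤ n) {s : ℕ} (S : PartitionSequence n)
        (stretch : ∀ i → 1 ≤ i → i ≤ n → ∀ x → StretchLe G pos (seq S i) x s) where

        private
          κ D : ℕ
          κ = threshold s
          D = (2 + κ) * maxDegree G

        few-whole : ∀ {X} → Few (seq S 1) (2 + κ) X
        few-whole = fromℕ< 1≤n ∷ [] , s≤s z≤n , λ v _ → here (last S _ v)

        -- Walks towards finer partitions until `X` first meets more than `κ` parts. One refinement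
        -- raises the bound by two, so `2 + κ` still holds there. `j` counts the merges left to
        -- undo.
        critical : ∀ {X} → Decidable X → ∀ j t → t + j ≡ n → 1 ≤ t → Few (seq S t) (2 + κ) X →
          ∃ λ i → 1 ≤ i × i ≤ n × Few (seq S i) (2 + κ) X × (¬ Few (seq S i) κ X ⊎ i ≡ n)
        critical X? j t t+j 1≤t few with few? {P = seq S t} X? κ
        ... | no ¬few = t , 1≤t , ≤-trans (m≤m+n t j) (≤-reflexive t+j) , few , inj₁ ¬few
        critical X? zero t t+j 1≤t few | yes _ =
          t , 1≤t , ≤-trans (m≤m+n t 0) (≤-reflexive t+j) , few , inj₂ (≡.trans (≡.sym (+-identityʳ t)) t+j)
        critical X? (suc j) t t+j 1≤t few | yes few′ =
          critical X? j (suc t) t+j′ (s≤s z≤n)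
            (few-refine (merges S t 1≤t (≤-trans (m≤m+n (suc t) j) (≤-reflexive t+j′))) few′)
          where t+j′ = ≡.trans (≡.sym (+-suc t j)) t+j

        -- Recursion shared with `goodCut-inside`: here the interval is halved and `ℓ` drops by one,
        -- there the partition is exchanged at a cost of `D`.
        goodCut-exists : ∀ ℓ t → 1 ≤ t → t ≤ n → ∀ a b → size a b < 2 ^ ℓ → ¬ Few (seq S t) κ (In a b) →
          ∃ λ q → a < q × q < b × GoodCut (seq S t) q (ℓ * D)

        goodCut-inside : ∀ ℓ t → 1 ≤ t → t ≤ n → ∀ a b → size a b < 2 ^ ℓ → ¬ Few (seq S t) (suc s) (In a b) →
          ∃ λ q → a < q × q < b × GoodCut (seq S t) q (suc ℓ * D)
        goodCut-inside ℓ t 1≤t t≤n a b small ¬few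
          -- The search starts at the coarsest partition whatever `t` is, so `i` may lie on either
          -- side of `t`.
          with critical (in? a b) (n ∸ 1) 1 (m+[n∸m]≡n 1≤n) ≤-refl few-whole
        ... | i , 1≤i , i≤n , few , inj₁ ¬few′ =
          let q , a<q , q<b , good = goodCut-exists ℓ i 1≤i i≤n a b small ¬few′ in
          q , a<q , q<b , goodCut-coarsen few good (nbhd-touches (stretch t 1≤t t≤n) ¬few a<q q<b)
        -- No edge is dead for the partition into singletons, so any position strictly inside
        -- serves.
        ... | _ , _ , _ , few , inj₂ refl =
          suc a , ≤-refl , a<b , goodCut-coarsen few (goodCut-singletons (first S))
            (nbhd-touches (stretch t 1≤t t≤n) ¬few ≤-refl a<b)
          where a<b = ¬few⇒1+< ¬few

        goodCut-exists zero t _ _ a b small ¬few = contradiction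
          (few-∅ λ v i → <⇒≱ small (count-positive (interval a b) v (interval⁺ i))) ¬few
        goodCut-exists (suc ℓ) t 1≤t t≤n a b small ¬few
          with few-split (seq S t) (suc s) (suc s) ¬few
        ... | x , ¬few₁ , ¬few₂ with size a x <? 2 ^ ℓ
        ...   | yes small₁ =
          let q , a<q , q<x , good = goodCut-inside ℓ t 1≤t t≤n a x small₁ ¬few₁ in
          q , a<q , <-trans q<x (¬few⇒< ¬few₂) , good
        ...   | no large₁ =
          let q , x<q , q<b , good = goodCut-inside ℓ t 1≤t t≤n x b small₂ ¬few₂ in
          q , <-trans (¬few⇒< ¬few₁) x<q , q<b , good
          where
          small₂ : size x b < 2 ^ ℓ
          small₂ = ≰⇒> λ large₂ → <⇒≱ small (≤-trans
            (≤-trans (≤-reflexive (cong (2 ^ ℓ +_) (+-identityʳ (2 ^ ℓ)))) (+-mono-≤ (≮⇒≥ large₁) large₂))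
            (size-split (<⇒≤ (¬few⇒< ¬few₁)) (<⇒≤ (¬few⇒< ¬few₂))))

        module _ (ℓ : ℕ) (n<2^ℓ : n < 2 ^ ℓ) where

          size< : ∀ a b → size a b < 2 ^ ℓ
          size< a b = ≤-<-trans (count≤length (interval a b) (allFin n) (λ v _ → ∈-allFin v))
            (≤-<-trans (≤-reflexive (length-tabulate id)) n<2^ℓ)

          cut-or-few : ∀ j t x y → t + j ≡ n → 1 ≤ t → suc x < y →
            (∃ λ q → x < q × q < y × GoodCut (seq S t) q (ℓ * D)) ⊎ (0 < j × Few (seq S t) κ (In x y))
          cut-or-few j t x y t+j 1≤t 1+x<y with few? {P = seq S t} (in? x y) κ
          cut-or-few j t x y t+j 1≤t 1+x<y | no ¬few =
            inj₁ (goodCut-exists ℓ t 1≤t (≤-trans (m≤m+n t j) (≤-reflexive t+j)) x y (size< x y) ¬few)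
          cut-or-few (suc j) t x y t+j 1≤t 1+x<y | yes few = inj₂ (z<s , few)
          cut-or-few zero t x y t+j 1≤t 1+x<y | yes _ rewrite ≡.trans (≡.sym (+-identityʳ t)) t+j =
            inj₁ (suc x , ≤-refl , 1+x<y , goodCut-mono z≤n (goodCut-singletons (first S)))

          -- The invariant is that few parts of the current partition meet `[x, y)` and that both
          -- ends are good cuts. `f` bounds the length: a cut lowers `f`, a refinement lowers `j`.
          carve : ∀ j f t x y → t + j ≡ n → 1 ≤ t → y ≤ x + f → Few (seq S t) (2 + κ) (In x y) →
            GoodCut (seq S t) x (ℓ * D) → GoodCut (seq S t) y (ℓ * D) →
            Carving G (cutSize (maxDegree G) s ℓ) (interval x y)
          carve j f t x y t+j 1≤t y≤ few good-x good-y with y ≤? suc x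
          ... | yes y≤1+x = tip λ u v u∈ v∈ → in-unique y≤1+x u v (interval⁻ u u∈) (interval⁻ v v∈)
          carve j zero t x y t+j 1≤t y≤ few good-x good-y | no y≰ =
            contradiction (≤-trans y≤ (≤-trans (≤-reflexive (+-identityʳ x)) (n≤1+n x))) y≰
          carve j (suc f) t x y t+j 1≤t y≤ few good-x good-y | no y≰ with cut-or-few j t x y t+j 1≤t (≰⇒> y≰)
          ... | inj₁ (q , x<q , q<y , good) = fork (interval-split (<⇒≤ x<q) (<⇒≤ q<y))
            (interval-cutHit few₁ good-x good) (interval-cutHit few₂ good good-y)
            (carve j f t x q t+j 1≤t (s≤s⁻¹ (≤-trans q<y y≤1+x+f)) few₁ good-x good)
            (carve j f t q y t+j 1≤t (≤-trans y≤1+x+f (+-monoˡ-≤ f x<q)) few₂ good good-y)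
            where
            y≤1+x+f = ≤-trans y≤ (≤-reflexive (+-suc x f))
            few₁ = few-mono ≤-refl (in-left (<⇒≤ q<y)) few
            few₂ = few-mono ≤-refl (in-right (<⇒≤ x<q)) few
          carve (suc j) (suc f) t x y t+j 1≤t y≤ few good-x good-y | no y≰ | inj₂ (_ , few′) =
            carve j (suc f) (suc t) x y t+j′ (s≤s z≤n) y≤ (few-refine merge few′)
              (goodCut-refine merge good-x) (goodCut-refine merge good-y)
            where
            t+j′ = ≡.trans (≡.sym (+-suc t j)) t+j
            merge = merges S t 1≤t (≤-trans (m≤m+n (suc t) j) (≤-reflexive t+j′))

          carving : Carving G (cutSize (maxDegree G) s ℓ) (interval 0 bound)
          carving = carve (n ∸ 1) bound 1 0 bound (m+[n∸m]≡n 1≤n) ≤-refl ≤-refl few-whole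
            -- No vertex lies before position `0` or from `bound` on, so empty hitting sets do at
            -- both ends.
            ([] , z≤n , λ _ _ _ ())
            ([] , z≤n , λ _ v _ _ bound≤ → contradiction (pos<bound v) (≤⇒≯ bound≤))

-- Numerical bounds and conclusion

n<2^[1+⌊log₂n⌋] : ∀ n → n < 2 ^ suc ⌊log₂ n ⌋
n<2^[1+⌊log₂n⌋] n = ≰⇒> λ 2^≤n → 1+n≰n
  (≤-trans (≤-reflexive (≡.sym (⌊log₂[2^n]⌋≡n (suc ⌊log₂ n ⌋)))) (⌊log₂⌋-mono-≤ 2^≤n))

-- When the logarithm is zero the claimed width is zero; the graph then has at most one vertex and
-- hence no edges.
maxDegree≡0-or-1≤log₂ : ∀ n (G : Graph n) → maxDegree G ≡ 0 ⊎ 1 ≤ ⌊log₂ n ⌋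
maxDegree≡0-or-1≤log₂ 0 G = inj₁ refl
maxDegree≡0-or-1≤log₂ 1 G rewrite irrefl G zero = inj₁ refl
maxDegree≡0-or-1≤log₂ (suc (suc n)) G = inj₂ (⌊log₂⌋-mono-≤ {2} {suc (suc n)} (s≤s (s≤s z≤n)))

-- The constant is `140 = 2 * 5 * 7 * 2`, from two cuts, `3 + 2 * L ≤ 5 * L`, `2 * s + 5 ≤ 7 * M`
-- and `suc Δ ≤ Δ + Δ`. The estimate is quadratic in `Δ` and linear in `M` before it is weakened.
cutSize-≤ : ∀ Δ s L → Δ ≡ 0 ⊎ 1 ≤ L →
  (cutSize Δ s (suc L) + cutSize Δ s (suc L)) * suc Δ ≤ 140 * Δ ^ 4 * (s ⊔ 1) ^ 2 * L
cutSize-≤ Δ s L (inj₁ refl) rewrite *-zeroʳ (2 + threshold s) | *-zeroʳ L = z≤n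
cutSize-≤ zero s L (inj₂ _) rewrite *-zeroʳ (2 + threshold s) | *-zeroʳ L = z≤n
cutSize-≤ Δ@(suc d) s L (inj₂ 1≤L) = begin
  (h + h) * suc Δ                                       ≤⟨ *-mono-≤ (+-mono-≤ h≤ h≤) (s≤s (m≤n+m Δ d)) ⟩
  (5 * L * (7 * M * Δ) + 5 * L * (7 * M * Δ)) * (Δ + Δ) ≡⟨ rearrange Δ L M ⟩
  140 * (Δ * Δ) * M * L                                 ≤⟨ *-monoˡ-≤ L (*-mono-≤ (*-monoʳ-≤ 140 Δ²≤Δ⁴) M≤M²) ⟩
  140 * Δ ^ 4 * M ^ 2 * L                               ∎
  where
  open ≤-Reasoning
  M = s ⊔ 1
  D = (2 + threshold s) * Δ
  h = cutSize Δ s (suc L)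
  rearrange : ∀ Δ L M → (5 * L * (7 * M * Δ) + 5 * L * (7 * M * Δ)) * (Δ + Δ) ≡ 140 * (Δ * Δ) * M * L
  rearrange = solve-∀
  Δ²≤Δ⁴ : Δ * Δ ≤ Δ ^ 4
  Δ²≤Δ⁴ = ≤-trans (≤-reflexive (cong (Δ *_) (≡.sym (*-identityʳ Δ)))) (^-monoʳ-≤ Δ {2} {4} (s≤s (s≤s z≤n)))
  M≤M² : M ≤ M ^ 2
  M≤M² = ≤-trans (≤-reflexive (≡.sym (*-identityʳ M))) (*-monoʳ-≤ M (≤-trans (m≤n⊔m s 1) (≤-reflexive (≡.sym (*-identityʳ M)))))
  2+threshold≤7M : 2 + threshold s ≤ 7 * M
  2+threshold≤7M = begin
    2 + threshold s ≡⟨ expand s ⟩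
    2 * s + 5 * 1 ≤⟨ +-mono-≤ (*-monoʳ-≤ 2 (m≤m⊔n s 1)) (*-monoʳ-≤ 5 (m≤n⊔m s 1)) ⟩
    2 * M + 5 * M ≡⟨ ≡.sym (*-distribʳ-+ M 2 5) ⟩
    7 * M         ∎
    where
    expand : ∀ s → 2 + (suc (suc s) + suc s) ≡ 2 * s + 5 * 1
    expand = solve-∀
  h≤ : h ≤ 5 * L * (7 * M * Δ)
  h≤ = begin
    h                 ≡⟨ collect L D ⟩
    (3 * 1 + 2 * L) * D ≤⟨ *-monoˡ-≤ D (+-monoˡ-≤ (2 * L) (*-monoʳ-≤ 3 1≤L)) ⟩
    (3 * L + 2 * L) * D ≡⟨ cong (_* D) (≡.sym (*-distribʳ-+ L 3 2)) ⟩
    5 * L * D         ≤⟨ *-monoʳ-≤ (5 * L) (*-monoˡ-≤ Δ 2+threshold≤7M) ⟩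
    5 * L * (7 * M * Δ) ∎
    where
    collect : ∀ L D → D + (suc L * D + suc L * D) ≡ (3 * 1 + 2 * L) * D
    collect = solve-∀

Δ-≤ : ∀ Δ s L → Δ ≡ 0 ⊎ 1 ≤ L → Δ ≤ 140 * Δ ^ 4 * (s ⊔ 1) ^ 2 * L
Δ-≤ Δ s L (inj₁ refl) = z≤n
Δ-≤ zero s L (inj₂ _) = z≤n
Δ-≤ Δ@(suc _) s L (inj₂ 1≤L) = begin
  Δ                             ≡⟨ ≡.sym (*-identityʳ Δ) ⟩
  Δ ^ 1                         ≤⟨ ^-monoʳ-≤ Δ {1} {4} (s≤s z≤n) ⟩
  Δ ^ 4                         ≤⟨ m≤n*m (Δ ^ 4) 140 ⟩
  140 * Δ ^ 4                   ≡⟨ ≡.sym (*-identityʳ _) ⟩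
  140 * Δ ^ 4 * 1               ≤⟨ *-monoʳ-≤ (140 * Δ ^ 4) (^-monoˡ-≤ 2 (m≤n⊔m s 1)) ⟩
  140 * Δ ^ 4 * (s ⊔ 1) ^ 2     ≡⟨ ≡.sym (*-identityʳ _) ⟩
  140 * Δ ^ 4 * (s ⊔ 1) ^ 2 * 1 ≤⟨ *-monoʳ-≤ (140 * Δ ^ 4 * (s ⊔ 1) ^ 2) 1≤L ⟩
  140 * Δ ^ 4 * (s ⊔ 1) ^ 2 * L ∎
  where open ≤-Reasoning

theorem5 : ∃ λ (c : ℕ) → ∀ (n : ℕ) (G : Graph n) (s : ℕ) → StwLe G s →
    TwLe G (c * maxDegree G ^ 4 * (s ⊔ 1) ^ 2 * ⌊log₂ n ⌋)
theorem5 = 140 , λ where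
  zero G s _ → carving⇒treeDecomposition G {h = 0} z≤n z≤n (tip {U = λ ()} λ ()) λ ()
  n@(suc _) G s (pos , pos-injective , S , stretch) →
    let Δ = maxDegree G ; L = ⌊log₂ n ⌋ ; bounded = maxDegree≡0-or-1≤log₂ n G in
    carving⇒treeDecomposition G
      (≤-trans (cutSize-≤ Δ s L bounded) (n≤1+n _)) (Δ-≤ Δ s L bounded)
      (carving G pos pos-injective z<s S stretch (suc L) (n<2^[1+⌊log₂n⌋] n))
      (λ v → interval⁺ G pos (z≤n , pos<bound G pos v))
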